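{- Let $\lambda$ be a nonzero real (or complex) number. For every $k\in\mathbb{N}=\{1,2,\dots\}$ and every integer $n\ge 0$, $$\beta_{n,\lambda}^{(k)}=(-1)^{n}\sum_{n_{1}+\cdots+n_{k}=n}\binom{n}{n_{1},n_{2},\dots,n_{k}}\frac{\beta_{n_{1},\lambda}(1-\lambda)}{n_{1}+1}\,\frac{\beta_{n_{2},\lambda}(1-\lambda)}{n_{1}+n_{2}+1}\cdots\frac{\beta_{n_{k-1},\lambda}(1-\lambda)}{n_{1}+n_{2}+\cdots+n_{k-1}+1}\,\beta_{n_{k},\lambda},$$ where the sum is over all $k$-tuples $(n_1,\dots,n_k)$ of nonnegative integers with sum $n$, $\binom{n}{n_1,\dots,n_k}=\frac{n!}{n_1!\cdots n_k!}$, and the product of the $k-1$ fractions is empty (equal to $1$) when $k=1$.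
   Context: All generating functions are formal power series. For nonzero $\lambda$ and any $x$, the degenerate exponential is $e_\lambda^x(t)=(1+\lambda t)^{x/\lambda}=\sum_{n\ge0}\binom{x/\lambda}{n}\lambda^n t^n$ and $e_\lambda(t)=e_\lambda^1(t)$. Carlitz's degenerate Bernoulli polynomials $\beta_{n,\lambda}(x)$ are defined by $\frac{t}{e_{\lambda}(t)-1}e_{\lambda}^{x}(t)=\sum_{n=0}^{\infty}\beta_{n,\lambda}(x)\frac{t^{n}}{n!}$, and $\beta_{n,\lambda}=\beta_{n,\lambda}(0)$. Here $\beta_{n,\lambda}(1-\lambda)$ denotes the value of this polynomial at $x=1-\lambda$. For nonzero $\mu$, put $(1)_{0,\mu}=1$ and $(1)_{n,\mu}=(1-\mu)(1-2\mu)\cdots(1-(n-1)\mu)$ for $n\ge1$ (so $(1)_{1,\mu}=1$). For $k\in\mathbb{Z}$ the degenerate polylogarithm function is $l_{k,\lambda}(x)=\sum_{n=1}^{\infty}\frac{(-\lambda)^{n-1}(1)_{n,1/\lambda}}{(n-1)!\,n^{k}}x^{n}$, and the degenerate poly-Bernoulli numbers $\beta_{n,\lambda}^{(k)}$ are defined by $$\frac{l_{k,\lambda}(1-e_{\lambda}(-t))}{1-e_{\lambda}(-t)}=\sum_{n=0}^{\infty}\beta_{n,\lambda}^{(k)}\frac{t^{n}}{n!},$$ i.e. by substituting $x=1-e_\lambda(-t)$ (which has zero constant term) into the power series $l_{k,\lambda}(x)/x$. -}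

module Defs where

open import Algebra.Apartness.Bundles using (HeytingCommutativeRing; HeytingField)
open import Algebra.Bundles using (CommutativeRing)
import Algebra.Apartness.Properties.HeytingCommutativeRing as HeytingProperties
import Algebra.Properties.CommutativeMonoid.Sum as MonoidSum
import Algebra.Properties.Semiring.Exp as Exp
import Algebra.Properties.Semiring.Mult as Mult
open import Data.Fin.Base using (Fin; zero; suc; toℕ)
open import Data.Integer.Base using (ℤ; +_; -[1+_])
open import Data.List.Base as List using (List; []; _∷_; concatMap; upTo)
open import Data.List.Membership.Propositional using (_∈_; find)
open import Data.List.Membership.Propositional.Properties
  using (∈-map⁺; ∈-map⁻; ∈-concatMap⁺; ∈-concatMap⁻; ∈-upTo⁺; ∈-upTo⁻)
open import Data.List.Relation.Unary.Any as Any using (here)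
import Data.List.Relation.Unary.All as All
import Data.List.Relation.Unary.All.Properties as All
import Data.List.Relation.Unary.AllPairs as AllPairs
import Data.List.Relation.Unary.AllPairs.Properties as AllPairs
open import Data.List.Relation.Unary.Unique.Propositional using (Unique)
import Data.List.Relation.Unary.Unique.Propositional.Properties as Unique
open import Data.Nat.Base as ℕ using (ℕ; zero; suc; NonZero; _∸_; _!; s≤s; s≤s⁻¹)
import Data.Nat.Properties as ℕ
open import Data.Nat.Properties using (_!≢0)
open import Data.Product.Base using (proj₁; proj₂; _,_)
open import Data.Vec.Base using (Vec; []; _∷_; sum)
open import Data.Vec.Properties using (∷-injectiveˡ; ∷-injectiveʳ)
open import Level using (Level)
open import Relation.Binary.PropositionalEquality as ≡ using (_≡_)
import Relation.Binary.Reasoning.Setoid as SetoidReasoning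

private variable
  c ℓ₁ ℓ₂ : Level
  k : ℕ

-- All k-tuples of natural numbers with sum n, each listed once.

tuples : (k n : ℕ) → List (Vec ℕ k)
tuples zero    zero    = [] ∷ []
tuples zero    (suc n) = []
tuples (suc k) n       = concatMap (λ i → List.map (i ∷_) (tuples k (n ∸ i))) (upTo (suc n))

∈-tuples⁺ : (ns : Vec ℕ k) → ns ∈ tuples k (sum ns)
∈-tuples⁺ []                   = here ≡.refl
∈-tuples⁺ {k = suc k} (i ∷ ns) =
  ∈-concatMap⁺ (λ j → List.map (j ∷_) (tuples k (i ℕ.+ sum ns ∸ j)))
    (Any.map (λ { ≡.refl → ∈-map⁺ (i ∷_) ns∈ }) (∈-upTo⁺ (s≤s (ℕ.m≤m+n i (sum ns)))))
  where
  ns∈ : ns ∈ tuples k (i ℕ.+ sum ns ∸ i)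
  ns∈ = ≡.subst (λ s → ns ∈ tuples k s) (≡.sym (ℕ.m+n∸m≡n i (sum ns))) (∈-tuples⁺ ns)

∈-tuples⁻ : ∀ k n {ns : Vec ℕ k} → ns ∈ tuples k n → sum ns ≡ n
∈-tuples⁻ zero    zero (here ≡.refl) = ≡.refl
∈-tuples⁻ (suc k) n    ns∈
  with i , i∈ , ns∈i ← find (∈-concatMap⁻ (λ j → List.map (j ∷_) (tuples k (n ∸ j))) {xs = upTo (suc n)} ns∈)
  with ms , ms∈ , ≡.refl ← ∈-map⁻ (i ∷_) ns∈i
  = ≡.trans (≡.cong (i ℕ.+_) (∈-tuples⁻ k (n ∸ i) ms∈)) (ℕ.m+[n∸m]≡n (s≤s⁻¹ (∈-upTo⁻ i∈)))

tuples-unique : ∀ k n → Unique (tuples k n)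
tuples-unique zero    zero    = All.[] AllPairs.∷ AllPairs.[]
tuples-unique zero    (suc n) = AllPairs.[]
tuples-unique (suc k) n       = Unique.concat⁺
  (All.map⁺ (All.universal (λ i → Unique.map⁺ ∷-injectiveʳ (tuples-unique k (n ∸ i))) (upTo (suc n))))
  (AllPairs.map⁺ (AllPairs.map disjoint (Unique.upTo⁺ (suc n))))
  where
  disjoint : ∀ {i j} → i ≡.≢ j → ∀ {ns} → _
  disjoint i≢j (ns∈i , ns∈j)
    with _ , _ , ≡.refl ← ∈-map⁻ (_ ∷_) ns∈i
    with _ , _ , eq ← ∈-map⁻ (_ ∷_) ns∈j
    = i≢j (∷-injectiveˡ eq)

prefixSum : Vec ℕ k → Fin k → ℕ
prefixSum (n ∷ ns) zero    = n
prefixSum (n ∷ ns) (suc i) = n ℕ.+ prefixSum ns i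

∏! : Vec ℕ k → ℕ
∏! []       = 1
∏! (n ∷ ns) = n ! ℕ.* ∏! ns

∏!≢0 : (ns : Vec ℕ k) → NonZero (∏! ns)
∏!≢0 []       = _
∏!≢0 (n ∷ ns) = ℕ.m*n≢0 (n !) (∏! ns) {{n !≢0}} {{∏!≢0 ns}}

CharacteristicZero : HeytingField c ℓ₁ ℓ₂ → Set ℓ₂
CharacteristicZero F = ∀ n → (suc n × 1#) # 0#
  where
  open HeytingField F
  open CommutativeRing (HeytingCommutativeRing.commutativeRing heytingCommutativeRing) using (semiring)
  open Mult semiring using (_×_)

module FieldOperations (F : HeytingField c ℓ₁ ℓ₂) (char0 : CharacteristicZero F) where

  open HeytingField F public
  open CommutativeRing (HeytingCommutativeRing.commutativeRing heytingCommutativeRing) public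
    using (ring; semiring; commutativeSemiring; +-commutativeMonoid; *-commutativeMonoid)
  open Mult semiring public using (_×_)
  open Exp semiring public using (_^_)
  open MonoidSum +-commutativeMonoid public using (sum-syntax; sum⁺-syntax)

  open HeytingProperties heytingCommutativeRing
  open SetoidReasoning setoid

  infix 10 ∏-syntax
  ∏-syntax : ∀ n → (Fin n → Carrier) → Carrier
  ∏-syntax n f = MonoidSum.sum *-commutativeMonoid f

  syntax ∏-syntax n (λ i → x) = ∏[ i < n ] x

  ∑-tuples : ∀ k n → (Vec ℕ k → Carrier) → Carrier
  ∑-tuples k n f = List.foldr _+_ 0# (List.map f (tuples k n))

  inverse : (x : Carrier) → x # 0# → Carrier
  inverse x x#0 = proj₁ (#⇒invertible x#0)

  *-inverseʳ : ∀ x (x#0 : x # 0#) → x * inverse x x#0 ≈ 1#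
  *-inverseʳ x x#0 = begin
    x * inverse x x#0         ≈⟨ *-congʳ (x-0≈x x) ⟨
    (x - 0#) * inverse x x#0  ≈⟨ proj₂ (proj₂ (#⇒invertible x#0)) ⟩
    1#                        ∎

  infixl 7 _/ℕ_
  _/ℕ_ : Carrier → (n : ℕ) → .{{NonZero n}} → Carrier
  x /ℕ suc n = x * inverse (suc n × 1#) (char0 n)

  -- x / nᵏ for an integer exponent k.
  divideByPower : Carrier → (n : ℕ) → .{{NonZero n}} → ℤ → Carrier
  divideByPower x n (+ k)    = _/ℕ_ x (n ℕ.^ k) {{ℕ.m^n≢0 n k}}
  divideByPower x n -[1+ k ] = (n ℕ.^ suc k) × x

  binomial : Carrier → ℕ → Carrier
  binomial x n = _/ℕ_ (∏[ i < n ] (x - toℕ i × 1#)) (n !) {{n !≢0}}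

  multinomial : ℕ → Vec ℕ k → Carrier
  multinomial n ns = _/ℕ_ ((n !) × 1#) (∏! ns) {{∏!≢0 ns}}

  binomial-0 : ∀ x → binomial x 0 ≈ 1#
  binomial-0 x = begin
    1# * inverse (1 × 1#) (char0 0)        ≈⟨ *-congʳ (+-identityʳ 1#) ⟨
    (1 × 1#) * inverse (1 × 1#) (char0 0)  ≈⟨ *-inverseʳ (1 × 1#) (char0 0) ⟩
    1#                                     ∎

  binomial-1 : ∀ x → binomial x 1 ≈ x
  binomial-1 x = begin
    ((x - 0#) * 1#) * u  ≈⟨ *-congʳ (*-identityʳ (x - 0#)) ⟩
    (x - 0#) * u         ≈⟨ *-congʳ (x-0≈x x) ⟩
    x * u                ≈⟨ *-congˡ (*-identityˡ u) ⟨
    x * (1# * u)         ≈⟨ *-congˡ (binomial-0 x) ⟩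
    x * 1#               ≈⟨ *-identityʳ x ⟩
    x                    ∎
    where u = inverse (1 × 1#) (char0 0)

  -- A formal power series is its sequence of coefficients.
  PowerSeries : Set c
  PowerSeries = ℕ → Carrier

  infix 4 _≋_
  _≋_ : PowerSeries → PowerSeries → Set ℓ₁
  f ≋ g = ∀ n → f n ≈ g n

  one : PowerSeries
  one zero    = 1#
  one (suc n) = 0#

  var : PowerSeries
  var zero          = 0#
  var (suc zero)    = 1#
  var (suc (suc n)) = 0#

  infixl 6 _⊖_
  _⊖_ : PowerSeries → PowerSeries → PowerSeries
  (f ⊖ g) n = f n - g n

  infixl 7 _⊛_
  _⊛_ : PowerSeries → PowerSeries → PowerSeries
  (f ⊛ g) n = ∑[ i ≤ n ] (f (toℕ i) * g (n ∸ toℕ i))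

  infixr 8 _^ₛ_
  _^ₛ_ : PowerSeries → ℕ → PowerSeries
  f ^ₛ zero  = one
  f ^ₛ suc n = f ⊛ f ^ₛ n

  -- f(-t)
  reflect : PowerSeries → PowerSeries
  reflect f n = (- 1#) ^ n * f n

  -- The series f(t)/t when f has zero constant term.
  shift : PowerSeries → PowerSeries
  shift f n = f (suc n)

  -- The series f(g(t)) when g has zero constant term: then gᵐ has no terms
  -- of degree below m, so the terms with m > n do not contribute.
  substitute : PowerSeries → PowerSeries → PowerSeries
  substitute f g n = ∑[ m ≤ n ] (f (toℕ m) * (g ^ₛ toℕ m) n)

  -- The quotient f/g, by long division.
  divide : (f g : PowerSeries) → g 0 # 0# → PowerSeries
  divide f g g₀#0 zero    = f 0 * inverse (g 0) g₀#0
  divide f g g₀#0 (suc n) =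
    divide (λ m → f (suc m) - (f 0 * inverse (g 0) g₀#0) * g (suc m)) g g₀#0 n

  -- The quotient f/g when f and g have zero constant term and the linear
  -- coefficient of g is invertible.
  divide₁ : (f g : PowerSeries) → g 1 # 0# → PowerSeries
  divide₁ f g = divide (shift f) (shift g)

  divide-⊛ : ∀ f g (g₀#0 : g 0 # 0#) → divide f g g₀#0 ⊛ g ≋ f
  divide-⊛ f g g₀#0 zero = begin
    (f 0 * g₀⁻¹) * g 0 + 0#  ≈⟨ +-identityʳ _ ⟩
    (f 0 * g₀⁻¹) * g 0       ≈⟨ *-assoc (f 0) g₀⁻¹ (g 0) ⟩
    f 0 * (g₀⁻¹ * g 0)       ≈⟨ *-congˡ (*-comm g₀⁻¹ (g 0)) ⟩
    f 0 * (g 0 * g₀⁻¹)       ≈⟨ *-congˡ (*-inverseʳ (g 0) g₀#0) ⟩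
    f 0 * 1#                 ≈⟨ *-identityʳ (f 0) ⟩
    f 0                      ∎
    where g₀⁻¹ = inverse (g 0) g₀#0
  divide-⊛ f g g₀#0 (suc n) = begin
    q * g (suc n) + (divide f′ g g₀#0 ⊛ g) n        ≈⟨ +-congˡ (divide-⊛ f′ g g₀#0 n) ⟩
    q * g (suc n) + (f (suc n) - q * g (suc n))     ≈⟨ +-comm _ _ ⟩
    (f (suc n) - q * g (suc n)) + q * g (suc n)     ≈⟨ +-assoc _ _ _ ⟩
    f (suc n) + (- (q * g (suc n)) + q * g (suc n)) ≈⟨ +-congˡ (-‿inverseˡ _) ⟩
    f (suc n) + 0#                                  ≈⟨ +-identityʳ _ ⟩
    f (suc n)                                       ∎
    where
    q = f 0 * inverse (g 0) g₀#0
    f′ : PowerSeries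
    f′ m = f (suc m) - q * g (suc m)

module Degenerate
  (F : HeytingField c ℓ₁ ℓ₂) (char0 : CharacteristicZero F)
  (lam : HeytingField.Carrier F)
  (lam#0 : HeytingField._#_ F lam (HeytingField.0# F))
  where

  open FieldOperations F char0 public
  open HeytingProperties heytingCommutativeRing
  open SetoidReasoning setoid

  1/lam : Carrier
  1/lam = inverse lam lam#0

  degExp : Carrier → PowerSeries
  degExp x n = binomial (x * 1/lam) n * lam ^ n

  degExp-0 : ∀ x → degExp x 0 ≈ 1#
  degExp-0 x = trans (*-identityʳ _) (binomial-0 (x * 1/lam))

  degExp-1 : ∀ x → degExp x 1 ≈ x
  degExp-1 x = begin
    binomial (x * 1/lam) 1 * (lam * 1#)  ≈⟨ *-cong (binomial-1 (x * 1/lam)) (*-identityʳ lam) ⟩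
    (x * 1/lam) * lam                    ≈⟨ *-assoc x 1/lam lam ⟩
    x * (1/lam * lam)                    ≈⟨ *-congˡ (*-comm 1/lam lam) ⟩
    x * (lam * 1/lam)                    ≈⟨ *-congˡ (*-inverseʳ lam lam#0) ⟩
    x * 1#                               ≈⟨ *-identityʳ x ⟩
    x                                    ∎

  degExp⊖one-1#0 : (degExp 1# ⊖ one) 1 # 0#
  degExp⊖one-1#0 = #-congʳ (sym (trans (x-0≈x (degExp 1# 1)) (degExp-1 1#))) 1#0

  -- Carlitz's degenerate Bernoulli polynomial βₙ at x: n! times the
  -- coefficient of tⁿ in t/(e(t) - 1) · eˣ(t).
  bernoulli : ℕ → Carrier → Carrier
  bernoulli n x = (n !) × (divide₁ var (degExp 1# ⊖ one) degExp⊖one-1#0 ⊛ degExp x) n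

  -- (1)ₙ,μ = (1 - μ)(1 - 2μ)⋯(1 - (n-1)μ)
  degFactorial : Carrier → ℕ → Carrier
  degFactorial μ n = ∏[ j < ℕ.pred n ] (1# - suc (toℕ j) × μ)

  polylog : ℤ → PowerSeries
  polylog k zero    = 0#
  polylog k (suc m) =
    divideByPower (_/ℕ_ ((- lam) ^ m * degFactorial 1/lam (suc m)) (m !) {{m !≢0}}) (suc m) k

  -- n! times the coefficient of tⁿ in l(u)/u for u = 1 - e(-t), obtained by
  -- substituting u into the series l(x)/x.
  polyBernoulli : ℤ → ℕ → Carrier
  polyBernoulli k n = (n !) × substitute (shift (polylog k)) (one ⊖ reflect (degExp 1#)) n

{-# OPTIONS --safe #-}
module Submission where

-- Write e = e_λ(t), E = e_λ^{1-λ}(t) = e′, v = 1 - e and P_k = (l_k(x)/x) ∘ v; the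
-- reflection t ↦ -t only contributes the sign (-1)ⁿ.  With B = t/(e - 1) and
-- h_k = P_{k+1}/B one has l_{k+1} ∘ v = -t h_k.  Since x l_{k+1}′ = l_k, the chain
-- rule gives (t h_k)′ = P_k E = h_{k-1} (B E), that is
--   (n+1) [tⁿ] h_k = [tⁿ] (h_{k-1} · B E),
-- and h_0 = 1 because l_1 is inverse to v up to sign.  Unrolling this recurrence in
-- P_{k+1} = h_k B yields the sum over tuples, the denominators being those n + 1.
-- That P_0 E = 1 follows from its derivative vanishing: P_0 = q ∘ v for a series
-- with (1 - x) q′ = (1 - λ) q, and (1 + λt) E′ = (1 - λ) E, (1 + λt) E = e = 1 - v.

open import Defs
import Algebra.Apartness.Properties.HeytingCommutativeRing as HeytingProperties
open import Algebra.Apartness.Bundles using (HeytingField)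
open import Algebra.Bundles using (CommutativeRing)
import Algebra.Construct.Pointwise as Pointwise
import Algebra.Properties.CommutativeMonoid.Sum as MonoidSum
import Algebra.Properties.Ring as RingProperties
import Algebra.Properties.Semiring.Exp as Exp
import Algebra.Properties.Semiring.Mult as Mult
import Algebra.Properties.Semiring.Sum as Sum
import Algebra.Solver.Ring.NaturalCoefficients.Default as Solver
open import Data.Fin.Base using (Fin; zero; suc; toℕ; inject₁)
open import Data.Fin.Properties using (toℕ≤pred[n])
open import Data.Integer.Base using (+_)
open import Data.List.Base as List using (List; []; _∷_; concatMap; upTo; applyUpTo)
import Data.List.Properties as List
open import Data.Nat.Base as ℕ using (ℕ; zero; suc; _∸_; _≤_; _<_; z≤n; s≤s; _!)
import Data.Nat.Properties as ℕ
open import Data.Nat.Properties using (_!≢0)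
open import Data.Product.Base using (_,_)
open import Data.Vec.Base using (Vec; []; _∷_; lookup; last)
open import Function.Base using (_∘_; id)
open import Relation.Binary.PropositionalEquality as ≡ using (_≡_)
import Relation.Binary.Reasoning.Setoid as SetoidReasoning

module SeriesAlgebra {c ℓ₁ ℓ₂} (F : HeytingField c ℓ₁ ℓ₂) (char0 : CharacteristicZero F) where

  open FieldOperations F char0
  open RingProperties ring using (-‿distribʳ-*)
  open Mult semiring using (×-congʳ; ×-congˡ; ×-homo-+; ×-homo-1; ×-comm-*; ×-assoc-*)
  open Exp semiring using (^-homo-*; ^-congʳ)
  open Sum semiring using (sum-cong-≋; sum-replicate-zero; ∑-distrib-+; ∑-comm; *-distribˡ-sum; *-distribʳ-sum)
  open Solver commutativeSemiring using (solve; _:+_; _:*_; _:=_; con)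
  open SetoidReasoning setoid

  ×≈×1* : ∀ n x → n × x ≈ (n × 1#) * x
  ×≈×1* n x = sym (trans (×-assoc-* n 1# x) (×-congʳ n (*-identityˡ x)))

  ×-zeroʳ : ∀ n → n × 0# ≈ 0#
  ×-zeroʳ n = trans (×≈×1* n 0#) (zeroʳ _)

  ×-neg : ∀ n x → n × (- x) ≈ - (n × x)
  ×-neg n x = begin
    n × (- x)           ≈⟨ ×≈×1* n (- x) ⟩
    (n × 1#) * - x      ≈⟨ -‿distribʳ-* _ x ⟨
    - ((n × 1#) * x)    ≈⟨ -‿cong (×≈×1* n x) ⟨
    - (n × x)           ∎

  ×-/ℕ : ∀ n .{{_ : ℕ.NonZero n}} x → n × (x /ℕ n) ≈ x
  ×-/ℕ (suc n) x = begin
    suc n × (x * i)         ≈⟨ ×≈×1* (suc n) _ ⟩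
    (suc n × 1#) * (x * i)  ≈⟨ solve 3 (λ a b d → a :* (b :* d) := b :* (a :* d)) refl (suc n × 1#) x i ⟩
    x * ((suc n × 1#) * i)  ≈⟨ *-congˡ (*-inverseʳ _ (char0 n)) ⟩
    x * 1#                  ≈⟨ *-identityʳ x ⟩
    x                       ∎
    where i = inverse (suc n × 1#) (char0 n)

  /ℕ-* : ∀ x n y → (x /ℕ suc n) * y ≈ x * ((1# /ℕ suc n) * y)
  /ℕ-* x n y = trans (*-assoc x _ y) (*-congˡ (*-congʳ (sym (*-identityˡ _))))

  ×-cancelˡ : ∀ n .{{_ : ℕ.NonZero n}} {x y} → n × x ≈ n × y → x ≈ y
  ×-cancelˡ (suc n) {x} {y} nx≈ny = trans (sym (lemma x)) (trans (*-congˡ nx≈ny) (lemma y))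
    where
    i = inverse (suc n × 1#) (char0 n)
    lemma : ∀ z → i * (suc n × z) ≈ z
    lemma z = begin
      i * (suc n × z)         ≈⟨ *-congˡ (×≈×1* (suc n) z) ⟩
      i * ((suc n × 1#) * z)  ≈⟨ solve 3 (λ a b d → a :* (b :* d) := d :* (b :* a)) refl i (suc n × 1#) z ⟩
      z * ((suc n × 1#) * i)  ≈⟨ *-congˡ (*-inverseʳ _ (char0 n)) ⟩
      z * 1#                  ≈⟨ *-identityʳ z ⟩
      z                       ∎

  ∑-cong : ∀ n {f g : Fin n → Carrier} → (∀ i → f i ≈ g i) → ∑[ i < n ] f i ≈ ∑[ i < n ] g i
  ∑-cong n = sum-cong-≋

  ∑-zero : ∀ n {f : Fin n → Carrier} → (∀ i → f i ≈ 0#) → ∑[ i < n ] f i ≈ 0#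
  ∑-zero n {f} f≈0 = trans (∑-cong n {f} f≈0) (sum-replicate-zero n)

  ∑-truncate : ∀ {a : ℕ → Carrier} n N → n ≤ N → (∀ m → n < m → a m ≈ 0#) →
               ∑[ m ≤ N ] a (toℕ m) ≈ ∑[ m ≤ n ] a (toℕ m)
  ∑-truncate zero    N       z≤n       a≈0 = +-congˡ (∑-zero N λ i → a≈0 (suc (toℕ i)) (s≤s z≤n))
  ∑-truncate (suc n) (suc N) (s≤s n≤N) a≈0 = +-congˡ (∑-truncate n N n≤N λ m n<m → a≈0 (suc m) (s≤s n<m))

  ∑-triangle : ∀ (T : ℕ → ℕ → Carrier) n →
               ∑[ j ≤ n ] ∑[ a ≤ toℕ j ] T (toℕ a) (toℕ j ∸ toℕ a)
                 ≈ ∑[ a ≤ n ] ∑[ i ≤ n ∸ toℕ a ] T (toℕ a) (toℕ i)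
  ∑-triangle T zero    = refl
  ∑-triangle T (suc n) = begin
    (T 0 0 + 0#) + ∑[ j ≤ n ] (T 0 (suc (toℕ j)) + ∑[ a ≤ toℕ j ] T (suc (toℕ a)) (toℕ j ∸ toℕ a))
      ≈⟨ +-cong (+-identityʳ _) 
           (∑-distrib-+ {suc n} (λ j → T 0 (suc (toℕ j))) (λ j → ∑[ a ≤ toℕ j ] T (suc (toℕ a)) (toℕ j ∸ toℕ a))) ⟩
    T 0 0 + (∑[ j ≤ n ] T 0 (suc (toℕ j)) + ∑[ j ≤ n ] ∑[ a ≤ toℕ j ] T (suc (toℕ a)) (toℕ j ∸ toℕ a))
      ≈⟨ +-assoc _ _ _ ⟨
    ∑[ j ≤ suc n ] T 0 (toℕ j) + ∑[ j ≤ n ] ∑[ a ≤ toℕ j ] T (suc (toℕ a)) (toℕ j ∸ toℕ a)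
      ≈⟨ +-congˡ (∑-triangle (λ a → T (suc a)) n) ⟩
    ∑[ j ≤ suc n ] T 0 (toℕ j) + ∑[ a ≤ n ] ∑[ i ≤ n ∸ toℕ a ] T (suc (toℕ a)) (toℕ i) ∎

  infixl 6 _⊕_
  _⊕_ : PowerSeries → PowerSeries → PowerSeries
  (f ⊕ g) n = f n + g n

  zeroₛ : PowerSeries
  zeroₛ n = 0#

  infixr 5 _∷ₛ_
  _∷ₛ_ : Carrier → PowerSeries → PowerSeries
  (a ∷ₛ f) zero    = a
  (a ∷ₛ f) (suc n) = f n

  constant : Carrier → PowerSeries
  constant a = a ∷ₛ zeroₛ

  constant-0# : constant 0# ≋ zeroₛ
  constant-0# zero    = refl
  constant-0# (suc n) = refl

  ⊛-cong : ∀ {f f′ g g′} → f ≋ f′ → g ≋ g′ → f ⊛ g ≋ f′ ⊛ g′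
  ⊛-cong f≋f′ g≋g′ n = ∑-cong (suc n) λ i → *-cong (f≋f′ (toℕ i)) (g≋g′ (n ∸ toℕ i))

  ⊛-congˡ : ∀ f {g g′} → g ≋ g′ → f ⊛ g ≋ f ⊛ g′
  ⊛-congˡ f {g} {g′} = ⊛-cong {f} {f} {g} {g′} λ _ → refl

  ⊛-congʳ : ∀ g {f f′} → f ≋ f′ → f ⊛ g ≋ f′ ⊛ g
  ⊛-congʳ g {f} {f′} f≋f′ = ⊛-cong {f} {f′} {g} {g} f≋f′ λ _ → refl

  ⊛-zeroˡ : ∀ f → zeroₛ ⊛ f ≋ zeroₛ
  ⊛-zeroˡ f n = ∑-zero (suc n) λ i → zeroˡ (f (n ∸ toℕ i))

  constant-⊛ : ∀ a f n → (constant a ⊛ f) n ≈ a * f n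
  constant-⊛ a f zero    = +-identityʳ _
  constant-⊛ a f (suc n) = trans (+-congˡ (⊛-zeroˡ f n)) (+-identityʳ _)

  one≋constant : one ≋ constant 1#
  one≋constant zero    = refl
  one≋constant (suc n) = refl

  ⊛-identityˡ : ∀ f → one ⊛ f ≋ f
  ⊛-identityˡ f n = begin
    (one ⊛ f) n          ≈⟨ ⊛-congʳ f one≋constant n ⟩
    (constant 1# ⊛ f) n  ≈⟨ constant-⊛ 1# f n ⟩
    1# * f n             ≈⟨ *-identityˡ _ ⟩
    f n                  ∎

  ⊛-distribʳ : ∀ h f g → (f ⊕ g) ⊛ h ≋ (f ⊛ h) ⊕ (g ⊛ h)
  ⊛-distribʳ h f g n = begin
    ((f ⊕ g) ⊛ h) n
      ≈⟨ ∑-cong (suc n) (λ i → distribʳ (h (n ∸ toℕ i)) (f (toℕ i)) (g (toℕ i))) ⟩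
    ∑[ i ≤ n ] (f (toℕ i) * h (n ∸ toℕ i) + g (toℕ i) * h (n ∸ toℕ i))
      ≈⟨ ∑-distrib-+ {suc n} (λ i → f (toℕ i) * h (n ∸ toℕ i)) (λ i → g (toℕ i) * h (n ∸ toℕ i)) ⟩
    (f ⊛ h) n + (g ⊛ h) n ∎

  ⊛-suc : ∀ f g n → (f ⊛ g) (suc n) ≈ f (suc n) * g 0 + (f ⊛ shift g) n
  ⊛-suc f g zero    =
    solve 4 (λ a b x y → a :* y :+ (b :* x :+ con 0) := b :* x :+ (a :* y :+ con 0)) refl (f 0) (f 1) (g 0) (g 1)
  ⊛-suc f g (suc n) = begin
    f 0 * g (2 ℕ.+ n) + (shift f ⊛ g) (suc n)                              ≈⟨ +-congˡ (⊛-suc (shift f) g n) ⟩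
    f 0 * g (2 ℕ.+ n) + (f (2 ℕ.+ n) * g 0 + (shift f ⊛ shift g) n)
      ≈⟨ solve 3 (λ a b d → a :+ (b :+ d) := b :+ (a :+ d)) refl _ _ _ ⟩
    f (2 ℕ.+ n) * g 0 + (f 0 * g (2 ℕ.+ n) + (shift f ⊛ shift g) n)        ∎

  ⊛-comm : ∀ f g → f ⊛ g ≋ g ⊛ f
  ⊛-comm f g zero    = +-congʳ (*-comm _ _)
  ⊛-comm f g (suc n) = begin
    (f ⊛ g) (suc n)                          ≈⟨ ⊛-suc f g n ⟩
    f (suc n) * g 0 + (f ⊛ shift g) n        ≈⟨ +-cong (*-comm _ _) (⊛-comm f (shift g) n) ⟩
    (g ⊛ f) (suc n)                          ∎

  scale-⊛ : ∀ a f g n → ((constant a ⊛ f) ⊛ g) n ≈ a * (f ⊛ g) n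
  scale-⊛ a f g n = begin
    ((constant a ⊛ f) ⊛ g) n
      ≈⟨ ∑-cong (suc n) (λ i → trans (*-congʳ (constant-⊛ a f (toℕ i))) (*-assoc a (f (toℕ i)) (g (n ∸ toℕ i)))) ⟩
    ∑[ i ≤ n ] (a * (f (toℕ i) * g (n ∸ toℕ i)))
      ≈⟨ *-distribˡ-sum {suc n} a (λ i → f (toℕ i) * g (n ∸ toℕ i)) ⟨
    a * (f ⊛ g) n ∎

  ⊛-assoc : ∀ f g h → (f ⊛ g) ⊛ h ≋ f ⊛ (g ⊛ h)
  ⊛-assoc f g h zero =
    solve 3 (λ x y z → (x :* y :+ con 0) :* z :+ con 0 := x :* (y :* z :+ con 0) :+ con 0) refl (f 0) (g 0) (h 0)
  ⊛-assoc f g h (suc n) = begin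
    (f 0 * g 0 + 0#) * h (suc n) + (shift (f ⊛ g) ⊛ h) n
      ≈⟨ +-cong (*-congʳ (+-identityʳ _)) 
           (⊛-congʳ h {shift (f ⊛ g)} {(constant (f 0) ⊛ shift g) ⊕ (shift f ⊛ g)}
             (λ m → +-congʳ {(shift f ⊛ g) m} (sym (constant-⊛ (f 0) (shift g) m))) n) ⟩
    (f 0 * g 0) * h (suc n) + (((constant (f 0) ⊛ shift g) ⊕ (shift f ⊛ g)) ⊛ h) n
      ≈⟨ +-congˡ (⊛-distribʳ h (constant (f 0) ⊛ shift g) (shift f ⊛ g) n) ⟩
    (f 0 * g 0) * h (suc n) + (((constant (f 0) ⊛ shift g) ⊛ h) n + ((shift f ⊛ g) ⊛ h) n)
      ≈⟨ +-congˡ (+-cong (scale-⊛ (f 0) (shift g) h n) (⊛-assoc (shift f) g h n)) ⟩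
    (f 0 * g 0) * h (suc n) + (f 0 * (shift g ⊛ h) n + (shift f ⊛ (g ⊛ h)) n)
      ≈⟨ solve 5 (λ a b x y z → (a :* b) :* x :+ (a :* y :+ z) := a :* (b :* x :+ y) :+ z) refl (f 0) (g 0) (h (suc n)) _ _ ⟩
    f 0 * (g ⊛ h) (suc n) + (shift f ⊛ (g ⊛ h)) n ∎

  ⊛-distribˡ : ∀ f g h → f ⊛ (g ⊕ h) ≋ (f ⊛ g) ⊕ (f ⊛ h)
  ⊛-distribˡ f g h n = begin
    (f ⊛ (g ⊕ h)) n        ≈⟨ ⊛-comm f (g ⊕ h) n ⟩
    ((g ⊕ h) ⊛ f) n        ≈⟨ ⊛-distribʳ f g h n ⟩
    (g ⊛ f) n + (h ⊛ f) n  ≈⟨ +-cong (⊛-comm g f n) (⊛-comm h f n) ⟩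
    (f ⊛ g) n + (f ⊛ h) n  ∎

  seriesRing : CommutativeRing c ℓ₁
  seriesRing = record
    { Carrier = PowerSeries
    ; _≈_ = _≋_ ; _+_ = _⊕_ ; _*_ = _⊛_ ; -_ = λ f n → - f n ; 0# = zeroₛ ; 1# = one
    ; isCommutativeRing = record
      { isRing = record
        { +-isAbelianGroup = Pointwise.isAbelianGroup ℕ +-isAbelianGroup
        ; *-cong = ⊛-cong
        ; *-assoc = ⊛-assoc
        ; *-identity = ⊛-identityˡ , λ f n → trans (⊛-comm f one n) (⊛-identityˡ f n)
        ; distrib = ⊛-distribˡ , ⊛-distribʳ
        }
      ; *-comm = ⊛-comm
      }
    }

  ×-∑ : ∀ k n (f : Fin n → Carrier) → k × (∑[ i < n ] f i) ≈ ∑[ i < n ] (k × f i)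
  ×-∑ k n f = begin
    k × (∑[ i < n ] f i)              ≈⟨ ×≈×1* k _ ⟩
    (k × 1#) * (∑[ i < n ] f i)       ≈⟨ *-distribˡ-sum (k × 1#) f ⟩
    ∑[ i < n ] ((k × 1#) * f i)       ≈⟨ ∑-cong n (λ i → ×≈×1* k (f i)) ⟨
    ∑[ i < n ] (k × f i)              ∎

  ×-⊛ : ∀ k f g → f ⊛ (λ n → k × g n) ≋ λ n → k × (f ⊛ g) n
  ×-⊛ k f g n = begin
    ∑[ i ≤ n ] (f (toℕ i) * (k × g (n ∸ toℕ i)))  ≈⟨ ∑-cong (suc n) (λ i → ×-comm-* k (f (toℕ i)) (g (n ∸ toℕ i))) ⟩
    ∑[ i ≤ n ] (k × (f (toℕ i) * g (n ∸ toℕ i)))  ≈⟨ ×-∑ k (suc n) (λ i → f (toℕ i) * g (n ∸ toℕ i)) ⟨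
    k × (f ⊛ g) n                                 ∎

  -- The Euler operator t d/dt, whose Leibniz rule holds term by term.
  euler : PowerSeries → PowerSeries
  euler f n = n × f n

  D : PowerSeries → PowerSeries
  D f = shift (euler f)

  euler-⊛ : ∀ f g → euler (f ⊛ g) ≋ (euler f ⊛ g) ⊕ (f ⊛ euler g)
  euler-⊛ f g n = begin
    n × (f ⊛ g) n
      ≈⟨ ×-∑ n (suc n) (λ i → f (toℕ i) * g (n ∸ toℕ i)) ⟩
    ∑[ i ≤ n ] (n × (f (toℕ i) * g (n ∸ toℕ i)))
      ≈⟨ ∑-cong (suc n) split ⟩
    ∑[ i ≤ n ] (euler f (toℕ i) * g (n ∸ toℕ i) + f (toℕ i) * euler g (n ∸ toℕ i))
      ≈⟨ ∑-distrib-+ {suc n} (λ i → euler f (toℕ i) * g (n ∸ toℕ i)) (λ i → f (toℕ i) * euler g (n ∸ toℕ i)) ⟩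
    (euler f ⊛ g) n + (f ⊛ euler g) n ∎
    where
    split : ∀ (i : Fin (suc n)) →
            n × (f (toℕ i) * g (n ∸ toℕ i)) ≈ euler f (toℕ i) * g (n ∸ toℕ i) + f (toℕ i) * euler g (n ∸ toℕ i)
    split i = begin
      n × (x * y)              ≈⟨ ×-congˡ (≡.sym (ℕ.m+[n∸m]≡n (toℕ≤pred[n] i))) ⟩
      (j ℕ.+ (n ∸ j)) × (x * y)  ≈⟨ ×-homo-+ (x * y) j (n ∸ j) ⟩
      j × (x * y) + (n ∸ j) × (x * y)  ≈⟨ +-cong (×-assoc-* j x y) (×-comm-* (n ∸ j) x y) ⟨
      (j × x) * y + x * ((n ∸ j) × y)  ∎
      where
      j = toℕ i
      x = f j
      y = g (n ∸ j)

  D-⊛ : ∀ f g → D (f ⊛ g) ≋ (D f ⊛ g) ⊕ (f ⊛ D g)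
  D-⊛ f g n = begin
    euler (f ⊛ g) (suc n)                                                ≈⟨ euler-⊛ f g (suc n) ⟩
    (0# * g (suc n) + (D f ⊛ g) n) + (f ⊛ euler g) (suc n)               ≈⟨ +-congˡ (⊛-suc f (euler g) n) ⟩
    (0# * g (suc n) + (D f ⊛ g) n) + (f (suc n) * 0# + (f ⊛ D g) n)
      ≈⟨ +-cong (trans (+-congʳ (zeroˡ _)) (+-identityˡ _)) (trans (+-congʳ (zeroʳ _)) (+-identityˡ _)) ⟩
    (D f ⊛ g) n + (f ⊛ D g) n ∎

  D-cong : ∀ {f g} → f ≋ g → D f ≋ D g
  D-cong f≋g n = ×-congʳ (suc n) (f≋g (suc n))

  D-^ₛ : ∀ f m → D (f ^ₛ suc m) ≋ λ n → suc m × (f ^ₛ m ⊛ D f) n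
  D-^ₛ f zero n = begin
    D (f ⊛ one) n     ≈⟨ D-cong (λ i → trans (⊛-comm f one i) (⊛-identityˡ f i)) n ⟩
    D f n             ≈⟨ ⊛-identityˡ (D f) n ⟨
    (one ⊛ D f) n     ≈⟨ ×-homo-1 _ ⟨
    1 × (one ⊛ D f) n ∎
  D-^ₛ f (suc m) n = begin
    D (f ⊛ f ^ₛ suc m) n
      ≈⟨ D-⊛ f (f ^ₛ suc m) n ⟩
    (D f ⊛ f ^ₛ suc m) n + (f ⊛ D (f ^ₛ suc m)) n
      ≈⟨ +-cong (⊛-comm (D f) (f ^ₛ suc m) n) power ⟩
    suc (suc m) × (f ^ₛ suc m ⊛ D f) n ∎
    where
    power : (f ⊛ D (f ^ₛ suc m)) n ≈ suc m × (f ^ₛ suc m ⊛ D f) n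
    power = begin
      (f ⊛ D (f ^ₛ suc m)) n                          ≈⟨ ⊛-congˡ f (D-^ₛ f m) n ⟩
      (f ⊛ (λ i → suc m × (f ^ₛ m ⊛ D f) i)) n        ≈⟨ ×-⊛ (suc m) f (f ^ₛ m ⊛ D f) n ⟩
      suc m × (f ⊛ (f ^ₛ m ⊛ D f)) n                  ≈⟨ ×-congʳ (suc m) (⊛-assoc f (f ^ₛ m) (D f) n) ⟨
      suc m × (f ^ₛ suc m ⊛ D f) n                    ∎

  ^ₛ-vanishes : ∀ f → f 0 ≈ 0# → ∀ m n → n < m → (f ^ₛ m) n ≈ 0#
  ^ₛ-vanishes f f₀≈0 (suc m) zero    n<m       = trans (+-identityʳ _) (trans (*-congʳ f₀≈0) (zeroˡ _))
  ^ₛ-vanishes f f₀≈0 (suc m) (suc n) (s≤s n<m) = begin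
    f 0 * (f ^ₛ m) (suc n) + (shift f ⊛ f ^ₛ m) n
      ≈⟨ +-cong (trans (*-congʳ f₀≈0) (zeroˡ _)) (∑-zero (suc n) λ i →
           trans (*-congˡ {f (suc (toℕ i))} (^ₛ-vanishes f f₀≈0 m (n ∸ toℕ i) (ℕ.≤-<-trans (ℕ.m∸n≤m n (toℕ i)) n<m))) (zeroʳ _)) ⟩
    0# + 0#  ≈⟨ +-identityʳ 0# ⟩
    0#       ∎

  -- ∑ₘ fₘ hₘ for series hₘ of order at least m.
  combine : PowerSeries → (ℕ → PowerSeries) → PowerSeries
  combine f h n = ∑[ m ≤ n ] (f (toℕ m) * h (toℕ m) n)

  combine-⊛ : ∀ f h g → (∀ m n → n < m → h m n ≈ 0#) → combine f h ⊛ g ≋ combine f (λ m → h m ⊛ g)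
  combine-⊛ f h g h≈0 n = begin
    ∑[ j ≤ n ] (combine f h (toℕ j) * g (n ∸ toℕ j))
      ≈⟨ ∑-cong (suc n) (λ j → *-congʳ {g (n ∸ toℕ j)} (∑-truncate {λ m → f m * h m (toℕ j)} (toℕ j) n (toℕ≤pred[n] j)
           λ m j<m → trans (*-congˡ (h≈0 m (toℕ j) j<m)) (zeroʳ _))) ⟨
    ∑[ j ≤ n ] ((∑[ m ≤ n ] (f (toℕ m) * h (toℕ m) (toℕ j))) * g (n ∸ toℕ j))
      ≈⟨ ∑-cong (suc n) (λ j → *-distribʳ-sum {suc n} (g (n ∸ toℕ j)) (λ m → f (toℕ m) * h (toℕ m) (toℕ j))) ⟩
    ∑[ j ≤ n ] ∑[ m ≤ n ] (f (toℕ m) * h (toℕ m) (toℕ j) * g (n ∸ toℕ j))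
      ≈⟨ ∑-comm {suc n} {suc n} (λ j m → f (toℕ m) * h (toℕ m) (toℕ j) * g (n ∸ toℕ j)) ⟩
    ∑[ m ≤ n ] ∑[ j ≤ n ] (f (toℕ m) * h (toℕ m) (toℕ j) * g (n ∸ toℕ j))
      ≈⟨ ∑-cong (suc n) (λ m → trans
           (∑-cong (suc n) λ j → *-assoc (f (toℕ m)) (h (toℕ m) (toℕ j)) (g (n ∸ toℕ j)))
           (sym (*-distribˡ-sum {suc n} (f (toℕ m)) (λ j → h (toℕ m) (toℕ j) * g (n ∸ toℕ j))))) ⟩
    combine f (λ m → h m ⊛ g) n ∎

  substitute-cong : ∀ {f f′} g → f ≋ f′ → substitute f g ≋ substitute f′ g
  substitute-cong g f≋f′ n = ∑-cong (suc n) λ m → *-congʳ {(g ^ₛ toℕ m) n} (f≋f′ (toℕ m))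

  substitute-⊕ : ∀ f f′ g → substitute (f ⊕ f′) g ≋ substitute f g ⊕ substitute f′ g
  substitute-⊕ f f′ g n = trans
    (∑-cong (suc n) λ m → distribʳ ((g ^ₛ toℕ m) n) (f (toℕ m)) (f′ (toℕ m)))
    (∑-distrib-+ {suc n} (λ m → f (toℕ m) * (g ^ₛ toℕ m) n) (λ m → f′ (toℕ m) * (g ^ₛ toℕ m) n))

  substitute-constant-⊛ : ∀ a f g → substitute (constant a ⊛ f) g ≋ constant a ⊛ substitute f g
  substitute-constant-⊛ a f g n = begin
    substitute (constant a ⊛ f) g n
      ≈⟨ ∑-cong (suc n) (λ m → trans (*-congʳ (constant-⊛ a f (toℕ m))) (*-assoc a (f (toℕ m)) ((g ^ₛ toℕ m) n))) ⟩
    ∑[ m ≤ n ] (a * (f (toℕ m) * (g ^ₛ toℕ m) n))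
      ≈⟨ *-distribˡ-sum {suc n} a (λ m → f (toℕ m) * (g ^ₛ toℕ m) n) ⟨
    a * substitute f g n
      ≈⟨ constant-⊛ a (substitute f g) n ⟨
    (constant a ⊛ substitute f g) n ∎

  substitute-horner : ∀ f g → g 0 ≈ 0# → substitute f g ≋ constant (f 0) ⊕ (g ⊛ substitute (shift f) g)
  substitute-horner f g g₀≈0 zero = begin
    f 0 * 1# + 0#                                   ≈⟨ +-cong (*-identityʳ _) (sym (trans (+-identityʳ _) (trans (*-congʳ g₀≈0) (zeroˡ _)))) ⟩
    f 0 + (g ⊛ substitute (shift f) g) 0            ∎
  substitute-horner f g g₀≈0 (suc n) = +-cong (zeroʳ _) (begin
    ∑[ m ≤ n ] a (toℕ m)
      ≈⟨ ∑-truncate {a} n (suc n) (ℕ.n≤1+n n) (λ m n<m →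
           trans (*-congˡ (^ₛ-vanishes g g₀≈0 (suc m) (suc n) (s≤s n<m))) (zeroʳ _)) ⟨
    ∑[ m ≤ suc n ] a (toℕ m)
      ≈⟨ ∑-cong (suc (suc n)) (λ m → *-congˡ {f (suc (toℕ m))} (⊛-comm g (g ^ₛ toℕ m) (suc n))) ⟩
    combine (shift f) (λ m → g ^ₛ m ⊛ g) (suc n)
      ≈⟨ combine-⊛ (shift f) (g ^ₛ_) g (^ₛ-vanishes g g₀≈0) (suc n) ⟨
    (substitute (shift f) g ⊛ g) (suc n)
      ≈⟨ ⊛-comm (substitute (shift f) g) g (suc n) ⟩
    (g ⊛ substitute (shift f) g) (suc n) ∎)
    where
    a : ℕ → Carrier
    a m = f (suc m) * (g ^ₛ suc m) (suc n)

  D-substitute : ∀ f g → g 0 ≈ 0# → D (substitute f g) ≋ substitute (D f) g ⊛ D g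
  D-substitute f g g₀≈0 n = begin
    suc n × (f 0 * 0# + ∑[ m ≤ n ] (f (suc (toℕ m)) * (g ^ₛ suc (toℕ m)) (suc n)))
      ≈⟨ ×-congʳ (suc n) (trans (+-congʳ (zeroʳ _)) (+-identityˡ _)) ⟩
    suc n × (∑[ m ≤ n ] (f (suc (toℕ m)) * (g ^ₛ suc (toℕ m)) (suc n)))
      ≈⟨ ×-∑ (suc n) (suc n) (λ m → f (suc (toℕ m)) * (g ^ₛ suc (toℕ m)) (suc n)) ⟩
    ∑[ m ≤ n ] (suc n × (f (suc (toℕ m)) * (g ^ₛ suc (toℕ m)) (suc n)))
      ≈⟨ ∑-cong (suc n) (λ m → term (toℕ m)) ⟩
    combine (D f) (λ m → g ^ₛ m ⊛ D g) n
      ≈⟨ combine-⊛ (D f) (g ^ₛ_) (D g) (^ₛ-vanishes g g₀≈0) n ⟨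
    (substitute (D f) g ⊛ D g) n ∎
    where
    term : ∀ m → suc n × (f (suc m) * (g ^ₛ suc m) (suc n)) ≈ D f m * (g ^ₛ m ⊛ D g) n
    term m = begin
      suc n × (f (suc m) * (g ^ₛ suc m) (suc n))  ≈⟨ ×-comm-* (suc n) (f (suc m)) _ ⟨
      f (suc m) * D (g ^ₛ suc m) n                ≈⟨ *-congˡ (D-^ₛ g m n) ⟩
      f (suc m) * (suc m × (g ^ₛ m ⊛ D g) n)      ≈⟨ ×-comm-* (suc m) (f (suc m)) _ ⟩
      suc m × (f (suc m) * (g ^ₛ m ⊛ D g) n)      ≈⟨ ×-assoc-* (suc m) (f (suc m)) _ ⟨
      D f m * (g ^ₛ m ⊛ D g) n                    ∎

  reflect-⊛ : ∀ f g → reflect f ⊛ reflect g ≋ reflect (f ⊛ g)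
  reflect-⊛ f g n = begin
    (reflect f ⊛ reflect g) n
      ≈⟨ ∑-cong (suc n) sign ⟩
    ∑[ i ≤ n ] ((- 1#) ^ n * (f (toℕ i) * g (n ∸ toℕ i)))
      ≈⟨ *-distribˡ-sum {suc n} ((- 1#) ^ n) (λ i → f (toℕ i) * g (n ∸ toℕ i)) ⟨
    reflect (f ⊛ g) n ∎
    where
    sign : ∀ (i : Fin (suc n)) → reflect f (toℕ i) * reflect g (n ∸ toℕ i) ≈ (- 1#) ^ n * (f (toℕ i) * g (n ∸ toℕ i))
    sign i = begin
      (s j * x) * (s (n ∸ j) * y)    ≈⟨ solve 4 (λ a b d e → (a :* b) :* (d :* e) := (a :* d) :* (b :* e)) refl (s j) x (s (n ∸ j)) y ⟩
      (s j * s (n ∸ j)) * (x * y)    ≈⟨ *-congʳ (^-homo-* (- 1#) j (n ∸ j)) ⟨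
      s (j ℕ.+ (n ∸ j)) * (x * y)    ≈⟨ *-congʳ (^-congʳ (- 1#) (ℕ.m+[n∸m]≡n (toℕ≤pred[n] i))) ⟩
      s n * (x * y)                  ∎
      where
      s : ℕ → Carrier
      s m = (- 1#) ^ m
      j = toℕ i
      x = f j
      y = g (n ∸ j)

  reflect-one : reflect one ≋ one
  reflect-one zero    = *-identityʳ 1#
  reflect-one (suc n) = zeroʳ _

  ^ₛ-reflect : ∀ {f g} → f ≋ reflect g → ∀ m → f ^ₛ m ≋ reflect (g ^ₛ m)
  ^ₛ-reflect         f≋g zero    n = sym (reflect-one n)
  ^ₛ-reflect {f} {g} f≋g (suc m) n = trans
    (⊛-cong {f} {reflect g} {f ^ₛ m} {reflect (g ^ₛ m)} f≋g (^ₛ-reflect f≋g m) n)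
    (reflect-⊛ g (g ^ₛ m) n)

  substitute-reflect : ∀ f {g h} → g ≋ reflect h → substitute f g ≋ reflect (substitute f h)
  substitute-reflect f {g} {h} g≋h n = begin
    substitute f g n
      ≈⟨ ∑-cong (suc n) (λ m → trans (*-congˡ (^ₛ-reflect g≋h (toℕ m) n))
           (solve 3 (λ a b d → a :* (b :* d) := b :* (a :* d)) refl (f (toℕ m)) ((- 1#) ^ n) ((h ^ₛ toℕ m) n))) ⟩
    ∑[ m ≤ n ] ((- 1#) ^ n * (f (toℕ m) * (h ^ₛ toℕ m) n))
      ≈⟨ *-distribˡ-sum {suc n} ((- 1#) ^ n) (λ m → f (toℕ m) * (h ^ₛ toℕ m) n) ⟨
    reflect (substitute f h) n ∎

module TupleSums {c ℓ₁ ℓ₂} (F : HeytingField c ℓ₁ ℓ₂) (char0 : CharacteristicZero F) where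
  open SeriesAlgebra F char0

  open FieldOperations F char0
  open Mult semiring using (×-congʳ; ×-congˡ; ×-assocˡ; ×-comm-*; ×-assoc-*)
  open Sum semiring using (*-distribˡ-sum; *-distribʳ-sum)
  open SetoidReasoning setoid

  ∑-list : ∀ {a} {A : Set a} → List A → (A → Carrier) → Carrier
  ∑-list xs f = List.foldr _+_ 0# (List.map f xs)

  ∑-list-cong : ∀ {a} {A : Set a} (xs : List A) {f g : A → Carrier} → (∀ x → f x ≈ g x) → ∑-list xs f ≈ ∑-list xs g
  ∑-list-cong []       f≈g = refl
  ∑-list-cong (x ∷ xs) f≈g = +-cong (f≈g x) (∑-list-cong xs f≈g)

  *-distribˡ-∑-list : ∀ {a} {A : Set a} x (xs : List A) f → x * ∑-list xs f ≈ ∑-list xs (λ y → x * f y)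
  *-distribˡ-∑-list x []       f = zeroʳ x
  *-distribˡ-∑-list x (y ∷ xs) f = trans (distribˡ _ _ _) (+-congˡ (*-distribˡ-∑-list x xs f))

  ∑-list-++ : ∀ {a} {A : Set a} (xs ys : List A) f → ∑-list (xs List.++ ys) f ≈ ∑-list xs f + ∑-list ys f
  ∑-list-++ []       ys f = sym (+-identityˡ _)
  ∑-list-++ (x ∷ xs) ys f = trans (+-congˡ (∑-list-++ xs ys f)) (sym (+-assoc _ _ _))

  ∑-list-map : ∀ {a b} {A : Set a} {B : Set b} (h : A → B) xs f → ∑-list (List.map h xs) f ≡ ∑-list xs (f ∘ h)
  ∑-list-map h xs f = ≡.cong (List.foldr _+_ 0#) (≡.sym (List.map-∘ xs))

  ∑-list-concatMap : ∀ {a b} {A : Set a} {B : Set b} (h : A → List B) xs f →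
                     ∑-list (concatMap h xs) f ≈ ∑-list xs (λ x → ∑-list (h x) f)
  ∑-list-concatMap h []       f = refl
  ∑-list-concatMap h (x ∷ xs) f = trans (∑-list-++ (h x) (concatMap h xs) f) (+-congˡ (∑-list-concatMap h xs f))

  ∑-list-applyUpTo : ∀ {a} {A : Set a} (h : ℕ → A) n f → ∑-list (applyUpTo h n) f ≈ ∑[ i < n ] f (h (toℕ i))
  ∑-list-applyUpTo h zero    f = refl
  ∑-list-applyUpTo h (suc n) f = +-congˡ (∑-list-applyUpTo (h ∘ suc) n f)

  ∑-tuples-suc : ∀ k n (f : Vec ℕ (suc k) → Carrier) →
                 ∑-tuples (suc k) n f ≈ ∑[ i ≤ n ] ∑-tuples k (n ∸ toℕ i) (λ ns → f (toℕ i ∷ ns))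
  ∑-tuples-suc k n f = begin
    ∑-tuples (suc k) n f
      ≈⟨ ∑-list-concatMap (λ i → List.map (i ∷_) (tuples k (n ∸ i))) (upTo (suc n)) f ⟩
    ∑-list (upTo (suc n)) (λ i → ∑-list (List.map (i ∷_) (tuples k (n ∸ i))) f)
      ≈⟨ ∑-list-applyUpTo id (suc n) (λ i → ∑-list (List.map (i ∷_) (tuples k (n ∸ i))) f) ⟩
    ∑[ i ≤ n ] ∑-list (List.map (toℕ i ∷_) (tuples k (n ∸ toℕ i))) f
      ≈⟨ ∑-cong (suc n) (λ i → reflexive (∑-list-map (toℕ i ∷_) (tuples k (n ∸ toℕ i)) f)) ⟩
    ∑[ i ≤ n ] ∑-tuples k (n ∸ toℕ i) (λ ns → f (toℕ i ∷ ns)) ∎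

  egfCoefficient : PowerSeries → ℕ → Carrier
  egfCoefficient f n = (n !) × f n

  1/suc : ℕ → Carrier
  1/suc n = 1# /ℕ suc n

  module _ (c b : PowerSeries) where

    -- The offset s stands for the sum of the entries already consumed.
    weight : ∀ k → ℕ → Vec ℕ (suc k) → Carrier
    weight zero    s (m ∷ _)  = b m
    weight (suc k) s (m ∷ ns) = (c m /ℕ suc (s ℕ.+ m)) * weight k (s ℕ.+ m) ns

    weightSum : ℕ → ℕ → ℕ → Carrier
    weightSum k s n = ∑-tuples (suc k) n (weight k s)

    weightSum-zero : ∀ s n → weightSum 0 s n ≈ b n
    weightSum-zero s n = begin
      weightSum 0 s n                                            ≈⟨ ∑-tuples-suc 0 n (weight 0 s) ⟩
      ∑[ i ≤ n ] ∑-tuples 0 (n ∸ toℕ i) (λ _ → b (toℕ i))        ≈⟨ ∑-cong (suc n) (λ i → empty (b (toℕ i)) (n ∸ toℕ i)) ⟩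
      (b ⊛ one) n                                                ≈⟨ ⊛-comm b one n ⟩
      (one ⊛ b) n                                                ≈⟨ ⊛-identityˡ b n ⟩
      b n                                                        ∎
      where
      empty : ∀ x m → ∑-tuples 0 m (λ _ → x) ≈ x * one m
      empty x zero    = trans (+-identityʳ x) (sym (*-identityʳ x))
      empty x (suc m) = sym (zeroʳ x)

    weightSum-suc : ∀ k s n → weightSum (suc k) s n ≈
                    ∑[ i ≤ n ] ((c (toℕ i) /ℕ suc (s ℕ.+ toℕ i)) * weightSum k (s ℕ.+ toℕ i) (n ∸ toℕ i))
    weightSum-suc k s n = trans (∑-tuples-suc (suc k) n (weight (suc k) s))
      (∑-cong (suc n) λ i → sym (*-distribˡ-∑-list (c (toℕ i) /ℕ suc (s ℕ.+ toℕ i)) (tuples (suc k) (n ∸ toℕ i)) (weight k (s ℕ.+ toℕ i))))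

    unrolled-recurrence : ∀ k (h : ℕ → PowerSeries) → (∀ j n → h (suc j) n ≈ (h j ⊛ c) n /ℕ suc n) →
                          ∀ n → (h k ⊛ b) n ≈ ∑[ j ≤ n ] (h 0 (toℕ j) * weightSum k (toℕ j) (n ∸ toℕ j))
    unrolled-recurrence zero    h rec n = ∑-cong (suc n) λ j → *-congˡ {h 0 (toℕ j)} (sym (weightSum-zero (toℕ j) (n ∸ toℕ j)))
    unrolled-recurrence (suc k) h rec n = begin
      (h (suc k) ⊛ b) n
        ≈⟨ unrolled-recurrence k (h ∘ suc) (rec ∘ suc) n ⟩
      ∑[ j ≤ n ] (h 1 (toℕ j) * weightSum k (toℕ j) (n ∸ toℕ j))
        ≈⟨ ∑-cong (suc n) (λ j → expand (toℕ j)) ⟩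
      ∑[ j ≤ n ] ∑[ a ≤ toℕ j ] T (toℕ a) (toℕ j ∸ toℕ a)
        ≈⟨ ∑-triangle T n ⟩
      ∑[ a ≤ n ] ∑[ i ≤ n ∸ toℕ a ] T (toℕ a) (toℕ i)
        ≈⟨ ∑-cong (suc n) (λ a → collect (toℕ a)) ⟩
      ∑[ a ≤ n ] (h 0 (toℕ a) * weightSum (suc k) (toℕ a) (n ∸ toℕ a)) ∎
      where
      u : ℕ → Carrier
      u j = 1/suc j * weightSum k j (n ∸ j)

      T : ℕ → ℕ → Carrier
      T a i = h 0 a * (c i * u (a ℕ.+ i))

      expand : ∀ j → h 1 j * weightSum k j (n ∸ j) ≈ ∑[ a ≤ j ] T (toℕ a) (j ∸ toℕ a)
      expand j = begin
        h 1 j * w                                             ≈⟨ *-congʳ (rec 0 j) ⟩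
        ((h 0 ⊛ c) j /ℕ suc j) * w                            ≈⟨ /ℕ-* ((h 0 ⊛ c) j) j w ⟩
        (h 0 ⊛ c) j * u j                                     ≈⟨ *-distribʳ-sum {suc j} (u j) (λ a → h 0 (toℕ a) * c (j ∸ toℕ a)) ⟩
        ∑[ a ≤ j ] (h 0 (toℕ a) * c (j ∸ toℕ a) * u j)        ≈⟨ ∑-cong (suc j) (λ a → trans (*-assoc (h 0 (toℕ a)) (c (j ∸ toℕ a)) (u j))
          (*-congˡ (*-congˡ (reflexive (≡.cong u (≡.sym (ℕ.m+[n∸m]≡n (toℕ≤pred[n] a)))))))) ⟩
        ∑[ a ≤ j ] T (toℕ a) (j ∸ toℕ a)                      ∎
        where w = weightSum k j (n ∸ j)

      collect : ∀ a → ∑[ i ≤ n ∸ a ] T a (toℕ i) ≈ h 0 a * weightSum (suc k) a (n ∸ a)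
      collect a = begin
        ∑[ i ≤ n ∸ a ] T a (toℕ i)
          ≈⟨ *-distribˡ-sum {suc (n ∸ a)} (h 0 a) (λ i → c (toℕ i) * u (a ℕ.+ toℕ i)) ⟨
        h 0 a * (∑[ i ≤ n ∸ a ] (c (toℕ i) * u (a ℕ.+ toℕ i)))
          ≈⟨ *-congˡ (∑-cong (suc (n ∸ a)) (λ i → term (toℕ i))) ⟩
        h 0 a * (∑[ i ≤ n ∸ a ] ((c (toℕ i) /ℕ suc (a ℕ.+ toℕ i)) * weightSum k (a ℕ.+ toℕ i) (n ∸ a ∸ toℕ i)))
          ≈⟨ *-congˡ (weightSum-suc k a (n ∸ a)) ⟨
        h 0 a * weightSum (suc k) a (n ∸ a) ∎
        where
        term : ∀ i → c i * u (a ℕ.+ i) ≈ (c i /ℕ suc (a ℕ.+ i)) * weightSum k (a ℕ.+ i) (n ∸ a ∸ i)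
        term i = trans (sym (/ℕ-* (c i) (a ℕ.+ i) _))
          (*-congˡ (reflexive (≡.cong (weightSum k (a ℕ.+ i)) (≡.sym (ℕ.∸-+-assoc n a i)))))

    ∏!×weight : ∀ k s (ns : Vec ℕ (suc k)) →
      ∏! ns × weight k s ns
        ≈ (∏[ i < k ] (egfCoefficient c (lookup ns (inject₁ i)) /ℕ suc (s ℕ.+ prefixSum ns (inject₁ i))))
          * egfCoefficient b (last ns)
    ∏!×weight zero s (m ∷ []) = begin
      (m ! ℕ.* 1) × b m    ≈⟨ ×-congˡ (ℕ.*-identityʳ (m !)) ⟩
      (m !) × b m            ≈⟨ *-identityˡ _ ⟨
      1# * ((m !) × b m)     ∎
    ∏!×weight (suc k) s (m ∷ ns@(_ ∷ _)) = begin
      (m ! ℕ.* ∏! ns) × ((c m /ℕ suc (s ℕ.+ m)) * w)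
        ≈⟨ ×-assocˡ _ (m !) (∏! ns) ⟨
      (m !) × (∏! ns × ((c m /ℕ suc (s ℕ.+ m)) * w))
        ≈⟨ ×-congʳ (m !) (×-comm-* (∏! ns) _ w) ⟨
      (m !) × ((c m /ℕ suc (s ℕ.+ m)) * (∏! ns × w))
        ≈⟨ ×-assoc-* (m !) _ _ ⟨
      ((m !) × (c m /ℕ suc (s ℕ.+ m))) * (∏! ns × w)
        ≈⟨ *-cong (sym (×-assoc-* (m !) (c m) _)) (∏!×weight k (s ℕ.+ m) ns) ⟩
      (((m !) × c m) /ℕ suc (s ℕ.+ m)) * (∏[ i < k ] (f i /ℕ suc (s ℕ.+ m ℕ.+ prefixSum ns (inject₁ i))) * z)
        ≈⟨ *-assoc _ _ _ ⟨
      (((m !) × c m) /ℕ suc (s ℕ.+ m)) * (∏[ i < k ] (f i /ℕ suc (s ℕ.+ m ℕ.+ prefixSum ns (inject₁ i)))) * z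
        ≈⟨ *-congʳ (*-congˡ (∏-cong λ i → reflexive (≡.cong (λ j → f i /ℕ suc j) (ℕ.+-assoc s m (prefixSum ns (inject₁ i)))))) ⟩
      (((m !) × c m) /ℕ suc (s ℕ.+ m)) * (∏[ i < k ] (f i /ℕ suc (s ℕ.+ (m ℕ.+ prefixSum ns (inject₁ i))))) * z ∎
      where
      open MonoidSum *-commutativeMonoid using () renaming (sum-cong-≋ to ∏-cong)
      w = weight k (s ℕ.+ m) ns
      z = egfCoefficient b (last ns)
      f : Fin k → Carrier
      f i = egfCoefficient c (lookup ns (inject₁ i))

    multinomial-weight : ∀ k n (ns : Vec ℕ (suc k)) →
      multinomial n ns
        * (∏[ i < k ] (egfCoefficient c (lookup ns (inject₁ i)) /ℕ suc (prefixSum ns (inject₁ i))))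
        * egfCoefficient b (last ns)
      ≈ (n !) × weight k 0 ns
    multinomial-weight k n ns = begin
      M * P * z                    ≈⟨ *-assoc M P z ⟩
      M * (P * z)                  ≈⟨ *-congˡ (∏!×weight k 0 ns) ⟨
      M * (∏! ns × w)              ≈⟨ ×-comm-* (∏! ns) M w ⟩
      ∏! ns × (M * w)              ≈⟨ ×-assoc-* (∏! ns) M w ⟨
      (∏! ns × M) * w              ≈⟨ *-congʳ (×-/ℕ (∏! ns) {{∏!≢0 ns}} ((n !) × 1#)) ⟩
      ((n !) × 1#) * w               ≈⟨ ×≈×1* (n !) w ⟨
      (n !) × w                      ∎
      where
      M = multinomial n ns
      P = ∏[ i < k ] (egfCoefficient c (lookup ns (inject₁ i)) /ℕ suc (prefixSum ns (inject₁ i)))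
      z = egfCoefficient b (last ns)
      w = weight k 0 ns

module RingLemmas {r ℓ} (R : CommutativeRing r ℓ) where
  open CommutativeRing R
  open RingProperties ring using (+-cancelʳ)
  open Solver commutativeSemiring using (solve; _:+_; _:*_; _:=_)
  open SetoidReasoning setoid

  *-leftInvertible-cancel : ∀ i f g → i * f ≈ 1# → f * g ≈ 0# → g ≈ 0#
  *-leftInvertible-cancel i f g if≈1 fg≈0 = begin
    g            ≈⟨ *-identityˡ g ⟨
    1# * g       ≈⟨ *-congʳ if≈1 ⟨
    (i * f) * g  ≈⟨ *-assoc i f g ⟩
    i * (f * g)  ≈⟨ *-congˡ fg≈0 ⟩
    i * 0#       ≈⟨ zeroʳ i ⟩
    0#           ∎

  insert-inverse : ∀ i f x y → i * f ≈ 1# → x * y ≈ (f * x) * (i * y)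
  insert-inverse i f x y if≈1 = begin
    x * y              ≈⟨ *-identityˡ _ ⟨
    1# * (x * y)       ≈⟨ *-congʳ if≈1 ⟨
    (i * f) * (x * y)  ≈⟨ solve 4 (λ i f x y → (i :* f) :* (x :* y) := (f :* x) :* (i :* y)) refl i f x y ⟩
    (f * x) * (i * y)  ∎

  move-term : ∀ e v κ q q′ → e + v ≈ 1# → q′ ≈ κ * q + v * q′ → e * q′ ≈ κ * q
  move-term e v κ q q′ e+v≈1 eq = +-cancelʳ (v * q′) _ _ (begin
    e * q′ + v * q′  ≈⟨ distribʳ q′ e v ⟨
    (e + v) * q′     ≈⟨ *-congʳ e+v≈1 ⟩
    1# * q′          ≈⟨ *-identityˡ q′ ⟩
    q′               ≈⟨ eq ⟩
    κ * q + v * q′   ∎)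

  product-rule-cancels : ∀ e κ q q′ E E′ → e * q′ ≈ κ * q → e * E′ ≈ κ * (E * E) →
                         e * (q′ * - E * E + q * E′) ≈ 0#
  product-rule-cancels e κ q q′ E E′ eq′≈κq eE′≈κEE = begin
    e * (q′ * - E * E + q * E′)
      ≈⟨ solve 6 (λ e q p m E F → e :* (p :* m :* E :+ q :* F) := (e :* p) :* (m :* E) :+ q :* (e :* F)) refl e q q′ (- E) E E′ ⟩
    (e * q′) * (- E * E) + q * (e * E′)
      ≈⟨ +-cong (*-congʳ eq′≈κq) (*-congˡ eE′≈κEE) ⟩
    (κ * q) * (- E * E) + q * (κ * (E * E))
      ≈⟨ solve 4 (λ k q m E → (k :* q) :* (m :* E) :+ q :* (k :* (E :* E)) := (k :* q :* E) :* (m :+ E)) refl κ q (- E) E ⟩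
    (κ * q * E) * (- E + E)
      ≈⟨ *-congˡ (-‿inverseˡ E) ⟩
    (κ * q * E) * 0#
      ≈⟨ zeroʳ _ ⟩
    0# ∎

  ode-product : ∀ w e κ E E′ → w * E ≈ e → w * E′ ≈ κ * E → e * E′ ≈ κ * (E * E)
  ode-product w e κ E E′ wE≈e wE′≈κE = begin
    e * E′        ≈⟨ *-congʳ wE≈e ⟨
    w * E * E′    ≈⟨ solve 3 (λ w E F → w :* E :* F := E :* (w :* F)) refl w E E′ ⟩
    E * (w * E′)  ≈⟨ *-congˡ wE′≈κE ⟩
    E * (κ * E)   ≈⟨ solve 2 (λ k E → E :* (k :* E) := k :* (E :* E)) refl κ E ⟩
    κ * (E * E)   ∎

module DegeneratePolyBernoulli {c ℓ₁ ℓ₂} (F : HeytingField c ℓ₁ ℓ₂) (char0 : CharacteristicZero F)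
  (lam : HeytingField.Carrier F) (lam#0 : HeytingField._#_ F lam (HeytingField.0# F)) where
  open SeriesAlgebra F char0
  open TupleSums F char0

  open Degenerate F char0 lam lam#0
  open HeytingProperties heytingCommutativeRing using (#-congʳ; 1#0)
  open RingProperties ring using (-0#≈0#; -‿distribˡ-*; -‿distribʳ-*; -‿involutive; -‿injective; -‿+-comm)
  open Mult semiring using (×-congʳ; ×-congˡ; ×-homo-1; ×-assocˡ; ×-comm-*; ×-assoc-*)
  open Solver commutativeSemiring using (solve; _:+_; _:*_; _:=_)
  open SetoidReasoning setoid
  open RingLemmas seriesRing
  module S = CommutativeRing seriesRing

  ∏-last : ∀ (g : ℕ → Carrier) n → ∏[ i < suc n ] g (toℕ i) ≈ (∏[ i < n ] g (toℕ i)) * g n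
  ∏-last g zero    = *-comm (g 0) 1#
  ∏-last g (suc n) = trans (*-congˡ (∏-last (g ∘ suc) n)) (sym (*-assoc _ _ _))

  factorial-suc : ∀ n x → (n !) × (suc n × x) ≈ (suc n !) × x
  factorial-suc n x = trans (×-assocˡ x (n !) (suc n)) (×-congˡ (ℕ.*-comm (n !) (suc n)))

  x-0×y≈x : ∀ x y → x - 0 × y ≈ x
  x-0×y≈x x y = trans (+-congˡ -0#≈0#) (+-identityʳ x)

  binomial-suc : ∀ x n → suc n × binomial x (suc n) ≈ (x - n × 1#) * binomial x n
  binomial-suc x n = ×-cancelˡ (n !) {{n !≢0}} (begin
    (n !) × (suc n × binomial x (suc n))            ≈⟨ factorial-suc n _ ⟩
    (suc n !) × binomial x (suc n)                  ≈⟨ ×-/ℕ (suc n !) {{suc n !≢0}} _ ⟩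
    ∏[ i < suc n ] (x - toℕ i × 1#)                 ≈⟨ ∏-last (λ i → x - i × 1#) n ⟩
    (∏[ i < n ] (x - toℕ i × 1#)) * (x - n × 1#)    ≈⟨ *-comm _ _ ⟩
    (x - n × 1#) * (∏[ i < n ] (x - toℕ i × 1#))    ≈⟨ *-congˡ (×-/ℕ (n !) {{n !≢0}} _) ⟨
    (x - n × 1#) * ((n !) × binomial x n)           ≈⟨ ×-comm-* (n !) _ _ ⟩
    (n !) × ((x - n × 1#) * binomial x n)           ∎)

  degExp-suc : ∀ x n → suc n × degExp x (suc n) ≈ (x - n × lam) * degExp x n
  degExp-suc x n = begin
    suc n × (binomial y (suc n) * (lam * lam ^ n))      ≈⟨ ×-assoc-* (suc n) _ _ ⟨
    (suc n × binomial y (suc n)) * (lam * lam ^ n)      ≈⟨ *-congʳ (binomial-suc y n) ⟩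
    ((y - n × 1#) * binomial y n) * (lam * lam ^ n)
      ≈⟨ solve 4 (λ a b l p → (a :* b) :* (l :* p) := (a :* l) :* (b :* p)) refl (y - n × 1#) (binomial y n) lam (lam ^ n) ⟩
    ((y - n × 1#) * lam) * degExp x n                   ≈⟨ *-congʳ factor ⟩
    (x - n × lam) * degExp x n                          ∎
    where
    y = x * 1/lam
    factor : (y - n × 1#) * lam ≈ x - n × lam
    factor = begin
      (y - n × 1#) * lam              ≈⟨ distribʳ lam y (- (n × 1#)) ⟩
      y * lam + - (n × 1#) * lam      ≈⟨ +-cong (trans (*-assoc x 1/lam lam) (*-congˡ (*-comm 1/lam lam))) (sym (-‿distribˡ-* (n × 1#) lam)) ⟩
      x * (lam * 1/lam) - (n × 1#) * lam ≈⟨ +-cong (trans (*-congˡ (*-inverseʳ lam lam#0)) (*-identityʳ x)) (-‿cong (sym (×≈×1* n lam))) ⟩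
      x - n × lam                     ∎

  degExp-unique : ∀ x f → f 0 ≈ 1# → (∀ n → suc n × f (suc n) ≈ (x - n × lam) * f n) → f ≋ degExp x
  degExp-unique x f f₀≈1 f-suc zero    = trans f₀≈1 (sym (degExp-0 x))
  degExp-unique x f f₀≈1 f-suc (suc n) = ×-cancelˡ (suc n) (begin
    suc n × f (suc n)            ≈⟨ f-suc n ⟩
    (x - n × lam) * f n          ≈⟨ *-congˡ (degExp-unique x f f₀≈1 f-suc n) ⟩
    (x - n × lam) * degExp x n   ≈⟨ degExp-suc x n ⟨
    suc n × degExp x (suc n)     ∎)

  one≋degExp-0# : one ≋ degExp 0#
  one≋degExp-0# = degExp-unique 0# one refl λ where
    zero    → trans (×-zeroʳ 1) (sym (trans (*-congʳ (x-0×y≈x 0# lam)) (zeroˡ 1#)))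
    (suc n) → trans (×-zeroʳ (suc (suc n))) (sym (zeroʳ _))

  e E v Y : PowerSeries
  e = degExp 1#
  E = degExp (1# - lam)
  v = one ⊖ e
  Y = shift (e ⊖ one)

  D-e : D e ≋ E
  D-e = degExp-unique (1# - lam) (D e) (trans (×-homo-1 (e 1)) (degExp-1 1#)) λ n → begin
    suc n × (suc (suc n) × e (suc (suc n)))        ≈⟨ ×-congʳ (suc n) (degExp-suc 1# (suc n)) ⟩
    suc n × ((1# - (lam + n × lam)) * e (suc n))   ≈⟨ ×-comm-* (suc n) _ _ ⟨
    (1# - (lam + n × lam)) * D e n                 ≈⟨ *-congʳ (trans (+-congˡ (sym (-‿+-comm lam (n × lam)))) (sym (+-assoc _ _ _))) ⟩
    (1# - lam - n × lam) * D e n                   ∎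

  1+lam·t : PowerSeries
  1+lam·t = 1# ∷ₛ constant lam

  degExp-ode : ∀ x → 1+lam·t ⊛ D (degExp x) ≋ constant x ⊛ degExp x
  degExp-ode x zero = +-congʳ (begin
    1# * D (degExp x) 0              ≈⟨ *-identityˡ _ ⟩
    1 × degExp x 1                   ≈⟨ degExp-suc x 0 ⟩
    (x - 0 × lam) * degExp x 0       ≈⟨ *-congʳ (x-0×y≈x x lam) ⟩
    x * degExp x 0                   ∎)
  degExp-ode x (suc n) = begin
    1# * D d (suc n) + (constant lam ⊛ D d) n
      ≈⟨ +-cong (*-identityˡ _) (constant-⊛ lam (D d) n) ⟩
    D d (suc n) + lam * D d n
      ≈⟨ +-cong (degExp-suc x (suc n)) (×-comm-* (suc n) lam _) ⟩
    (x - suc n × lam) * d (suc n) + suc n × (lam * d (suc n))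
      ≈⟨ +-congˡ (×-assoc-* (suc n) lam _) ⟨
    (x - suc n × lam) * d (suc n) + (suc n × lam) * d (suc n)
      ≈⟨ distribʳ _ _ _ ⟨
    (x - suc n × lam + suc n × lam) * d (suc n)
      ≈⟨ *-congʳ (trans (+-assoc _ _ _) (trans (+-congˡ (-‿inverseˡ _)) (+-identityʳ x))) ⟩
    x * d (suc n)
      ≈⟨ constant-⊛ x d (suc n) ⟨
    (constant x ⊛ d) (suc n) ∎
    where d = degExp x

  [1+lam·t]⊛E≋e : 1+lam·t ⊛ E ≋ e
  [1+lam·t]⊛E≋e n = begin
    (1+lam·t ⊛ E) n        ≈⟨ ⊛-congˡ 1+lam·t D-e n ⟨
    (1+lam·t ⊛ D e) n      ≈⟨ degExp-ode 1# n ⟩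
    (constant 1# ⊛ e) n    ≈⟨ constant-⊛ 1# e n ⟩
    1# * e n               ≈⟨ *-identityˡ _ ⟩
    e n                    ∎

  v₀≈0 : v 0 ≈ 0#
  v₀≈0 = trans (+-congˡ (-‿cong (degExp-0 1#))) (-‿inverseʳ 1#)

  e⊕v≋one : e ⊕ v ≋ one
  e⊕v≋one n = begin
    e n + (one n - e n)      ≈⟨ +-comm _ _ ⟩
    one n - e n + e n        ≈⟨ +-assoc _ _ _ ⟩
    one n + (- e n + e n)    ≈⟨ +-congˡ (-‿inverseˡ _) ⟩
    one n + 0#               ≈⟨ +-identityʳ _ ⟩
    one n                    ∎

  D-v : D v ≋ S.- E
  D-v n = begin
    suc n × (0# - e (suc n))   ≈⟨ ×-congʳ (suc n) (+-identityˡ _) ⟩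
    suc n × (- e (suc n))      ≈⟨ ×-neg (suc n) _ ⟩
    - (D e n)                  ≈⟨ -‿cong (D-e n) ⟩
    - E n                      ∎

  polylog-suc : ∀ k n → suc n × polylog (+ suc k) (suc n) ≈ polylog (+ k) (suc n)
  polylog-suc k n = ×-cancelˡ (suc n ℕ.^ k) {{ℕ.m^n≢0 (suc n) k}} (begin
    (suc n ℕ.^ k) × (suc n × polylog (+ suc k) (suc n))   ≈⟨ ×-assocˡ _ (suc n ℕ.^ k) (suc n) ⟩
    (suc n ℕ.^ k ℕ.* suc n) × polylog (+ suc k) (suc n)   ≈⟨ ×-congˡ (ℕ.*-comm (suc n ℕ.^ k) (suc n)) ⟩
    (suc n ℕ.^ suc k) × polylog (+ suc k) (suc n)         ≈⟨ ×-/ℕ (suc n ℕ.^ suc k) {{ℕ.m^n≢0 (suc n) (suc k)}} _ ⟩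
    _                                                     ≈⟨ ×-/ℕ (suc n ℕ.^ k) {{ℕ.m^n≢0 (suc n) k}} _ ⟨
    (suc n ℕ.^ k) × polylog (+ k) (suc n)                 ∎)

  q : PowerSeries
  q = shift (polylog (+ 0))

  m!×q : ∀ m → (m !) × q m ≈ (- lam) ^ m * degFactorial 1/lam (suc m)
  m!×q m = begin
    (m !) × q m              ≈⟨ ×-congʳ (m !) (×-homo-1 (q m)) ⟨
    (m !) × (1 × q m)        ≈⟨ ×-congʳ (m !) (×-/ℕ 1 _) ⟩
    (m !) × (_/ℕ_ ((- lam) ^ m * degFactorial 1/lam (suc m)) (m !) {{m !≢0}}) ≈⟨ ×-/ℕ (m !) {{m !≢0}} _ ⟩
    (- lam) ^ m * degFactorial 1/lam (suc m) ∎

  q₀≈1 : q 0 ≈ 1#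
  q₀≈1 = trans (sym (×-homo-1 (q 0))) (trans (m!×q 0) (*-identityʳ 1#))

  q-suc : ∀ m → suc m × q (suc m) ≈ (suc m × 1# - lam) * q m
  q-suc m = ×-cancelˡ (m !) {{m !≢0}} (begin
    (m !) × (suc m × q (suc m))                 ≈⟨ factorial-suc m _ ⟩
    (suc m !) × q (suc m)                       ≈⟨ m!×q (suc m) ⟩
    (- lam * l) * (∏[ j < suc m ] (1# - suc (toℕ j) × 1/lam))  ≈⟨ *-congˡ (∏-last (λ j → 1# - suc j × 1/lam) m) ⟩
    (- lam * l) * (d * (1# - suc m × 1/lam))
      ≈⟨ solve 4 (λ n l d x → (n :* l) :* (d :* x) := (n :* x) :* (l :* d)) refl (- lam) l d (1# - suc m × 1/lam) ⟩
    (- lam * (1# - suc m × 1/lam)) * (l * d)    ≈⟨ *-cong factor (sym (m!×q m)) ⟩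
    (suc m × 1# - lam) * ((m !) × q m)          ≈⟨ ×-comm-* (m !) _ _ ⟩
    (m !) × ((suc m × 1# - lam) * q m)          ∎)
    where
    l = (- lam) ^ m
    d = degFactorial 1/lam (suc m)
    factor : - lam * (1# - suc m × 1/lam) ≈ suc m × 1# - lam
    factor = begin
      - lam * (1# - suc m × 1/lam)                   ≈⟨ distribˡ _ _ _ ⟩
      - lam * 1# + - lam * - (suc m × 1/lam)         ≈⟨ +-cong (*-identityʳ _) (sym (-‿distribˡ-* lam _)) ⟩
      - lam - lam * - (suc m × 1/lam)                ≈⟨ +-congˡ (-‿cong (-‿distribʳ-* lam _)) ⟨
      - lam + - - (lam * (suc m × 1/lam))            ≈⟨ +-congˡ (-‿involutive _) ⟩
      - lam + lam * (suc m × 1/lam)                  ≈⟨ +-congˡ (×-comm-* (suc m) lam 1/lam) ⟩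
      - lam + suc m × (lam * 1/lam)                  ≈⟨ +-congˡ (×-congʳ (suc m) (*-inverseʳ lam lam#0)) ⟩
      - lam + suc m × 1#                             ≈⟨ +-comm _ _ ⟩
      suc m × 1# - lam                               ∎

  -- (1 - x) q′ = (1 - λ) q, as q = (1 - x)^(λ-1).
  q-ode : D q ≋ (constant (1# - lam) ⊛ q) ⊕ euler q
  q-ode n = begin
    suc n × q (suc n)                         ≈⟨ q-suc n ⟩
    (1# + n × 1# - lam) * q n                 ≈⟨ *-congʳ (solve 3 (λ a b d → a :+ b :+ d := a :+ d :+ b) refl 1# (n × 1#) (- lam)) ⟩
    (1# - lam + n × 1#) * q n                 ≈⟨ distribʳ _ _ _ ⟩
    (1# - lam) * q n + (n × 1#) * q n         ≈⟨ +-cong (constant-⊛ (1# - lam) q n) (×≈×1* n (q n)) ⟨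
    (constant (1# - lam) ⊛ q) n + n × q n     ∎

  P : ℕ → PowerSeries
  P k = substitute (shift (polylog (+ k))) v

  e⊛q′∘v : e ⊛ substitute (D q) v ≋ constant (1# - lam) ⊛ P 0
  e⊛q′∘v = move-term e v (constant (1# - lam)) (P 0) (substitute (D q) v) e⊕v≋one λ n → begin
    substitute (D q) v n
      ≈⟨ substitute-cong v q-ode n ⟩
    substitute ((constant (1# - lam) ⊛ q) ⊕ euler q) v n
      ≈⟨ substitute-⊕ (constant (1# - lam) ⊛ q) (euler q) v n ⟩
    substitute (constant (1# - lam) ⊛ q) v n + substitute (euler q) v n
      ≈⟨ +-cong (substitute-constant-⊛ (1# - lam) q v n) (substitute-horner (euler q) v v₀≈0 n) ⟩
    (constant (1# - lam) ⊛ P 0) n + (constant 0# n + (v ⊛ substitute (D q) v) n)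
      ≈⟨ +-congˡ (trans (+-congʳ (constant-0# n)) (+-identityˡ _)) ⟩
    (constant (1# - lam) ⊛ P 0) n + (v ⊛ substitute (D q) v) n ∎

  e₀#0 : e 0 # 0#
  e₀#0 = #-congʳ (sym (degExp-0 1#)) 1#0

  D[P₀⊛E]≋0 : D (P 0 ⊛ E) ≋ zeroₛ
  D[P₀⊛E]≋0 = *-leftInvertible-cancel (divide one e e₀#0) e (D (P 0 ⊛ E)) (divide-⊛ one e e₀#0) λ n → begin
    (e ⊛ D (P 0 ⊛ E)) n
      ≈⟨ ⊛-congˡ e expand n ⟩
    (e ⊛ ((substitute (D q) v ⊛ (S.- E) ⊛ E) ⊕ (P 0 ⊛ D E))) n
      ≈⟨ product-rule-cancels e (constant (1# - lam)) (P 0) (substitute (D q) v) E (D E) e⊛q′∘v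
           (ode-product 1+lam·t e (constant (1# - lam)) E (D E) [1+lam·t]⊛E≋e (degExp-ode (1# - lam))) n ⟩
    0# ∎
    where
    expand : D (P 0 ⊛ E) ≋ (substitute (D q) v ⊛ (S.- E) ⊛ E) ⊕ (P 0 ⊛ D E)
    expand n = trans (D-⊛ (P 0) E n) (+-congʳ (⊛-congʳ E {D (P 0)} {substitute (D q) v ⊛ (S.- E)}
      (λ m → trans (D-substitute q v v₀≈0 m) (⊛-congˡ (substitute (D q) v) D-v m)) n))

  P₀⊛E≋one : P 0 ⊛ E ≋ one
  P₀⊛E≋one zero = begin
    (q 0 * 1# + 0#) * E 0 + 0#   ≈⟨ +-identityʳ _ ⟩
    (q 0 * 1# + 0#) * E 0        ≈⟨ *-cong (trans (+-identityʳ _) (*-identityʳ _)) (degExp-0 (1# - lam)) ⟩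
    q 0 * 1#                     ≈⟨ *-identityʳ _ ⟩
    q 0                          ≈⟨ q₀≈1 ⟩
    1#                           ∎
  P₀⊛E≋one (suc n) = ×-cancelˡ (suc n) (trans (D[P₀⊛E]≋0 n) (sym (×-zeroʳ (suc n))))

  h : ℕ → PowerSeries
  h k = Y ⊛ P (suc k)

  substitute-polylog : ∀ k n → substitute (polylog (+ suc k)) v (suc n) ≈ - h k n
  substitute-polylog k n = begin
    substitute (polylog (+ suc k)) v (suc n)         ≈⟨ substitute-horner (polylog (+ suc k)) v v₀≈0 (suc n) ⟩
    0# + (v 0 * p (suc n) + (shift v ⊛ p) n)         ≈⟨ +-identityˡ _ ⟩
    v 0 * p (suc n) + (shift v ⊛ p) n                ≈⟨ trans (+-congʳ (trans (*-congʳ v₀≈0) (zeroˡ _))) (+-identityˡ _) ⟩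
    (shift v ⊛ p) n                                  ≈⟨ ⊛-congʳ p {shift v} {S.- Y} (λ m → sym (⁻¹-anti-homo‿- (e (suc m)) 0#)) n ⟩
    ((S.- Y) ⊛ p) n                                  ≈⟨ S-‿distribˡ-* Y p n ⟨
    - h k n                                          ∎
    where
    p = P (suc k)
    open RingProperties ring using (⁻¹-anti-homo‿-)
    open RingProperties S.ring using () renaming (-‿distribˡ-* to S-‿distribˡ-*)

  suc×h : ∀ k n → suc n × h k n ≈ (P k ⊛ E) n
  suc×h k n = -‿injective (begin
    - (suc n × h k n)                             ≈⟨ ×-neg (suc n) _ ⟨
    suc n × (- h k n)                             ≈⟨ ×-congʳ (suc n) (substitute-polylog k n) ⟨
    D (substitute (polylog (+ suc k)) v) n        ≈⟨ D-substitute (polylog (+ suc k)) v v₀≈0 n ⟩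
    (substitute (D (polylog (+ suc k))) v ⊛ D v) n
      ≈⟨ ⊛-cong {substitute (D (polylog (+ suc k))) v} {P k} {D v} {S.- E} (substitute-cong v (polylog-suc k)) D-v n ⟩
    (P k ⊛ (S.- E)) n                             ≈⟨ S-‿distribʳ-* (P k) E n ⟨
    - (P k ⊛ E) n                                 ∎)
    where open RingProperties S.ring using () renaming (-‿distribʳ-* to S-‿distribʳ-*)

  B₁ C₁ : PowerSeries
  B₁ = divide₁ var (e ⊖ one) degExp⊖one-1#0
  C₁ = B₁ ⊛ E

  B⊛Y≋one : B₁ ⊛ Y ≋ one
  B⊛Y≋one n = trans (divide-⊛ (shift var) Y degExp⊖one-1#0 n) (shift-var n)
    where
    shift-var : shift var ≋ one
    shift-var zero    = refl
    shift-var (suc n) = refl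

  h₀≋one : h 0 ≋ one
  h₀≋one n = ×-cancelˡ (suc n) (trans (suc×h 0 n) (trans (P₀⊛E≋one n) (sym (suc×one n))))
    where
    suc×one : ∀ n → suc n × one n ≈ one n
    suc×one zero    = ×-homo-1 1#
    suc×one (suc n) = ×-zeroʳ (suc (suc n))

  h-suc : ∀ k n → h (suc k) n ≈ (h k ⊛ C₁) n /ℕ suc n
  h-suc k n = ×-cancelˡ (suc n) (begin
    suc n × h (suc k) n                  ≈⟨ suc×h (suc k) n ⟩
    (P (suc k) ⊛ E) n                    ≈⟨ insert-inverse B₁ Y (P (suc k)) E B⊛Y≋one n ⟩
    (h k ⊛ C₁) n                         ≈⟨ ×-/ℕ (suc n) _ ⟨
    suc n × ((h k ⊛ C₁) n /ℕ suc n)      ∎)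

  B₀ : PowerSeries
  B₀ = B₁ ⊛ degExp 0#

  P≋h⊛B₀ : ∀ k → P (suc k) ≋ h k ⊛ B₀
  P≋h⊛B₀ k n = begin
    P (suc k) n                ≈⟨ S.*-identityʳ (P (suc k)) n ⟨
    (P (suc k) ⊛ one) n        ≈⟨ ⊛-congˡ (P (suc k)) one≋degExp-0# n ⟩
    (P (suc k) ⊛ degExp 0#) n  ≈⟨ insert-inverse B₁ Y (P (suc k)) (degExp 0#) B⊛Y≋one n ⟩
    (h k ⊛ B₀) n               ∎

  P≈weightSum : ∀ k n → P (suc k) n ≈ weightSum C₁ B₀ k 0 n
  P≈weightSum k n = begin
    P (suc k) n                                               ≈⟨ P≋h⊛B₀ k n ⟩
    (h k ⊛ B₀) n                                              ≈⟨ unrolled-recurrence C₁ B₀ k h h-suc n ⟩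
    ∑[ j ≤ n ] (h 0 (toℕ j) * w (toℕ j))                      ≈⟨ ∑-cong (suc n) (λ j → *-congʳ {w (toℕ j)} (h₀≋one (toℕ j))) ⟩
    1# * w 0 + ∑[ j < n ] (0# * w (suc (toℕ j)))              ≈⟨ +-cong (*-identityˡ _) (∑-zero n λ j → zeroˡ (w (suc (toℕ j)))) ⟩
    w 0 + 0#                                                  ≈⟨ +-identityʳ _ ⟩
    w 0                                                       ∎
    where
    w : ℕ → Carrier
    w j = weightSum C₁ B₀ k j (n ∸ j)

  polyBernoulli≈ : ∀ k n → polyBernoulli (+ k) n ≈ (- 1#) ^ n * ((n !) × substitute (shift (polylog (+ k))) v n)
  polyBernoulli≈ k n = begin
    (n !) × substitute (shift (polylog (+ k))) (one ⊖ reflect e) n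
      ≈⟨ ×-congʳ (n !) (substitute-reflect (shift (polylog (+ k))) reflect-v n) ⟩
    (n !) × ((- 1#) ^ n * P k n)
      ≈⟨ ×-comm-* (n !) _ _ ⟨
    (- 1#) ^ n * ((n !) × P k n) ∎
    where
    reflect-v : one ⊖ reflect e ≋ reflect v
    reflect-v m = begin
      one m - (- 1#) ^ m * e m                     ≈⟨ +-cong (sym (reflect-one m)) (-‿distribʳ-* _ _) ⟩
      (- 1#) ^ m * one m + (- 1#) ^ m * - e m      ≈⟨ distribˡ _ _ _ ⟨
      (- 1#) ^ m * (one m - e m)                   ∎

  polyBernoulli-∑-tuples : ∀ (k n : ℕ) →
    polyBernoulli (+ suc k) n
      ≈ (- 1#) ^ n
        * ∑-tuples (suc k) n (λ ns →
            multinomial n ns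
            * (∏[ i < k ] (bernoulli (lookup ns (inject₁ i)) (1# - lam) /ℕ suc (prefixSum ns (inject₁ i))))
            * bernoulli (last ns) 0#)
  polyBernoulli-∑-tuples k n = begin
    polyBernoulli (+ suc k) n
      ≈⟨ polyBernoulli≈ (suc k) n ⟩
    (- 1#) ^ n * ((n !) × P (suc k) n)
      ≈⟨ *-congˡ (×-congʳ (n !) (P≈weightSum k n)) ⟩
    (- 1#) ^ n * ((n !) × weightSum C₁ B₀ k 0 n)
      ≈⟨ *-congˡ (trans (×≈×1* (n !) _) (*-distribˡ-∑-list ((n !) × 1#) (tuples (suc k) n) (weight C₁ B₀ k 0))) ⟩
    (- 1#) ^ n * ∑-tuples (suc k) n (λ ns → ((n !) × 1#) * weight C₁ B₀ k 0 ns)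
      ≈⟨ *-congˡ (∑-list-cong (tuples (suc k) n) λ ns →
           trans (sym (×≈×1* (n !) _)) (sym (multinomial-weight C₁ B₀ k n ns))) ⟩
    _ ∎

theorem6 : ∀ {c ℓ₁ ℓ₂} (F : HeytingField c ℓ₁ ℓ₂) (char0 : CharacteristicZero F)
  (lam : HeytingField.Carrier F) (lam#0 : HeytingField._#_ F lam (HeytingField.0# F)) →
  let open Degenerate F char0 lam lam#0 in
  ∀ (k n : ℕ) →
  polyBernoulli (+ suc k) n
    ≈ (- 1#) ^ n
      * ∑-tuples (suc k) n (λ ns →
          multinomial n ns
          * (∏[ i < k ] (bernoulli (lookup ns (inject₁ i)) (1# - lam) /ℕ suc (prefixSum ns (inject₁ i))))
          * bernoulli (last ns) 0#)
theorem6 = DegeneratePolyBernoulli.polyBernoulli-∑-tuples
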